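{- Every ($2K_2$, paw)-free graph $G$ on $n$ vertices is recolorable, and the diameter of $R_\ell(G)$ is at most $2n^2$ for all $\ell\ge\chi(G)+1$.
   Context: All graphs are finite and simple. A $k$-coloring of $G$ is a map $V(G)\to\{1,\dots,k\}$ giving adjacent vertices different values; $\chi(G)$ is the chromatic number. $R_k(G)$ denotes the graph whose vertices are the $k$-colorings of $G$, two being adjacent if they differ in color on exactly one vertex. $G$ is recolorable if $R_\ell(G)$ is connected for all $\ell\ge\chi(G)+1$. A graph is $(H_1,H_2)$-free if it has no induced subgraph isomorphic to $H_1$ or $H_2$. $2K_2$ is the disjoint union of two edges; the paw is a triangle together with one extra vertex adjacent to exactly one vertex of the triangle. -}

module Defs where

open import Data.Fin.Base using (Fin; zero)
open import Data.Fin.Properties using (any?; all?) renaming (_≟_ to _≟ᶠ_)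
open import Data.Maybe.Base using (Maybe; just; nothing)
open import Data.Nat.Base using (ℕ; zero; suc; _+_; _≤_; _≥_)
open import Data.Product using (∃-syntax; ∃!; _×_; _,_)
open import Data.Sum.Base using (_⊎_)
open import Data.Sum.Relation.Binary.Pointwise
  using (Pointwise; inj₁; inj₂; ⊎-symmetric; ⊎-decidable)
open import Data.Vec.Base using (Vec; lookup)
open import Function.Base using (_∘_)
open import Function.Bundles using (_⇔_)
open import Function.Definitions using (Injective)
open import Level using (0ℓ)
open import Relation.Binary.Core using (Rel)
open import Relation.Binary.Definitions using (Decidable; Symmetric)
open import Relation.Binary.PropositionalEquality.Core
  using (_≡_; _≢_; refl; sym)
open import Relation.Nullary.Decidable using (map′; no; ¬?; _×-dec_; _→-dec_)
open import Relation.Nullary.Negation using (¬_)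

-- Simple graphs.  Adjacency is required to be decidable, which for finite
-- graphs is no restriction classically.
record Graph (V : Set) : Set₁ where
  field
    Adj    : Rel V 0ℓ
    adj?   : Decidable Adj
    symm   : Symmetric Adj
    irrefl : ∀ {v} → ¬ Adj v v

open Graph public

record InducedEmbedding {V W : Set} (H : Graph V) (G : Graph W) : Set where
  field
    to        : V → W
    injective : Injective _≡_ _≡_ to
    adj-iff   : ∀ u v → Adj H u v ⇔ Adj G (to u) (to v)

_-Free_ : {V W : Set} → Graph V → Graph W → Set
H -Free G = ¬ InducedEmbedding H G

complete : ∀ n → Graph (Fin n)
complete n = record
  { Adj    = _≢_
  ; adj?   = λ i j → ¬? (i ≟ᶠ j)
  ; symm   = λ i≢j → i≢j ∘ sym
  ; irrefl = λ i≢i → i≢i refl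
  }

_⊎ᴳ_ : {V W : Set} → Graph V → Graph W → Graph (V ⊎ W)
G ⊎ᴳ H = record
  { Adj    = Pointwise (Adj G) (Adj H)
  ; adj?   = ⊎-decidable (adj? G) (adj? H)
  ; symm   = ⊎-symmetric (symm G) (symm H)
  ; irrefl = λ { (inj₁ e) → irrefl G e ; (inj₂ e) → irrefl H e }
  }

2K₂ : Graph (Fin 2 ⊎ Fin 2)
2K₂ = complete 2 ⊎ᴳ complete 2

-- `nothing` is the extra vertex attached to the triangle.
data PawAdj : Rel (Maybe (Fin 3)) 0ℓ where
  triangle : ∀ {i j} → i ≢ j → PawAdj (just i) (just j)
  pendantˡ : PawAdj nothing (just zero)
  pendantʳ : PawAdj (just zero) nothing

paw : Graph (Maybe (Fin 3))
paw = record
  { Adj    = PawAdj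
  ; adj?   = dec
  ; symm   = λ { (triangle i≢j) → triangle (i≢j ∘ sym)
               ; pendantˡ → pendantʳ
               ; pendantʳ → pendantˡ }
  ; irrefl = λ { (triangle i≢i) → i≢i refl }
  }
  where
  dec : Decidable PawAdj
  dec (just i) (just j) =
    map′ triangle (λ { (triangle i≢j) → i≢j }) (¬? (i ≟ᶠ j))
  dec (just i) nothing  =
    map′ (λ { refl → pendantʳ }) (λ { pendantʳ → refl }) (i ≟ᶠ zero)
  dec nothing  (just j) =
    map′ (λ { refl → pendantˡ }) (λ { pendantˡ → refl }) (j ≟ᶠ zero)
  dec nothing  nothing  = no λ ()

-- The map is stored as a vector, so that colorings that agree on every vertex
-- are propositionally equal without function extensionality.
record Coloring {n : ℕ} (G : Graph (Fin n)) (k : ℕ) : Set where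
  field
    colors : Vec (Fin k) n
    proper : ∀ u v → Adj G u v → lookup colors u ≢ lookup colors v

  color : Fin n → Fin k
  color = lookup colors

open Coloring public

IsChromaticNumber : {n : ℕ} → Graph (Fin n) → ℕ → Set
IsChromaticNumber G χ = Coloring G χ × (∀ k → Coloring G k → χ ≤ k)

DifferAt : {n k : ℕ} {G : Graph (Fin n)} → Coloring G k → Coloring G k → Fin n → Set
DifferAt α β v = color α v ≢ color β v

R : {n : ℕ} (k : ℕ) (G : Graph (Fin n)) → Graph (Coloring G k)
R {n} k G = record
  { Adj    = λ α β → ∃! _≡_ (DifferAt α β)
  ; adj?   = dec
  ; symm   = λ { (v , d , unique) → v , d ∘ sym , λ d′ → unique (d′ ∘ sym) }
  ; irrefl = λ { (_ , d , _) → d refl }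
  }
  where
  differ? : (α β : Coloring G k) (v : Fin n) → _
  differ? α β v = ¬? (color α v ≟ᶠ color β v)

  dec : Decidable (λ (α β : Coloring G k) → ∃! _≡_ (DifferAt α β))
  dec α β = map′
    (λ { (v , d , unique) → v , d , λ {w} → unique w })
    (λ { (v , d , unique) → v , d , λ w → unique {w} })
    (any? λ v → differ? α β v ×-dec all? λ w → differ? α β w →-dec (v ≟ᶠ w))

data Walk {V : Set} (G : Graph V) : V → V → ℕ → Set where
  nil  : ∀ {u} → Walk G u u 0
  cons : ∀ {u v w m} → Adj G u v → Walk G v w m → Walk G u w (suc m)

Connected : {V : Set} → Graph V → Set
Connected G = ∀ u v → ∃[ m ] Walk G u v m

IsDistance : {V : Set} → Graph V → V → V → ℕ → Set
IsDistance G u v d = Walk G u v d × (∀ m → Walk G u v m → d ≤ m)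

-- D is the maximum of the distances between pairs of vertices.
IsDiameter : {V : Set} → Graph V → ℕ → Set
IsDiameter G D =
  (∀ u v → ∃[ d ] IsDistance G u v d × d ≤ D) ×
  (∃[ u ] ∃[ v ] IsDistance G u v D)

Recolorable : {n : ℕ} → Graph (Fin n) → Set
Recolorable G = ∀ χ → IsChromaticNumber G χ → ∀ ℓ → ℓ ≥ χ + 1 → Connected (R ℓ G)

{-# OPTIONS --safe #-}

-- If N(v) ⊆ N(w), then v can take over the color of w.  A (2K₂, paw)-free graph G
-- retracts in this way onto a core H that is a complete graph or a 5-cycle:
-- a maximal clique if G has a triangle, else a 5-cycle if there is one, else an
-- edge of maximal degree sum (or at most a vertex if G has no edges).
-- If ℓ exceeds every degree in H by at least 2, each vertex has a spare color, so
-- the k vertices of H reach their target colors by at most 2k recolorings of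
-- independent sets.  Pulled back to G, each of these costs at most n steps; the
-- two passages between a coloring of G and one pulled back from H cost another
-- 2n, and are needed only if k < n.
module Submission where

open import Defs
open import Data.Bool.Base using (if_then_else_)
open import Data.Fin.Base using (Fin; zero; suc; toℕ; inject≤)
open import Data.Fin.Patterns using (0F; 1F; 2F; 3F; 4F)
open import Data.Fin.Properties
  using (any?; all?; injective⇒≤; inject≤-injective; toℕ<n; toℕ-injective; ¬∀⟶∃¬)
  renaming (_≟_ to _≟ᶠ_)
open import Data.Fin.Subset using (Subset; ∣_∣; _∈_)
open import Data.Fin.Subset.Properties using (p⊂q⇒∣p∣<∣q∣; ∣p∣≤n)
open import Data.Maybe.Base using (just; nothing)
open import Data.Nat.Base using (ℕ; zero; suc; _+_; _*_; _^_; _≤_; _<_; _≥_; z≤n; s≤s; s≤s⁻¹)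
open import Data.Nat.Properties
  using (≤-refl; ≤-reflexive; ≤-trans; ≤∧≢⇒<; <⇒≱; n≤0⇒n≡0;
         m≤m+n; +-comm; +-suc; +-mono-≤; +-cancelˡ-≤; +-cancelʳ-≤; *-monoˡ-≤)
  renaming (_≟_ to _≟ⁿ_)
open import Data.Nat.Solver using (module +-*-Solver)
open import Data.Product.Base using (∃; Σ; ∃-syntax; _×_; _,_; proj₁; proj₂; swap; uncurry)
open import Data.Sum.Base using (_⊎_; inj₁; inj₂; [_,_]′)
open import Data.Sum.Relation.Binary.Pointwise using ()
  renaming (inj₁ to left; inj₂ to right)
open import Data.Unit.Base using (⊤; tt)
open import Data.Vec.Base using (Vec; []; _∷_; lookup; tabulate)
open import Data.Vec.Properties
  using (lookup∘tabulate; tabulate∘lookup; tabulate-cong; lookup⇒[]=; []=⇒lookup)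
  renaming (≡-dec to ≡ᵛ-dec)
open import Function.Base using (_∘_; _$_)
open import Function.Bundles using (mk⇔)
open import Relation.Binary.PropositionalEquality
  using (_≡_; _≢_; refl; sym; trans; cong; subst)
open import Relation.Nullary.Decidable
  using (Dec; yes; no; does; map′; ¬?; _×-dec_; _→-dec_; _⊎-dec_; dec-true; decidable-stable)
open import Relation.Nullary.Negation using (¬_; contradiction)
open import Relation.Unary using (Decidable)

open +-*-Solver using (solve; _:+_; _:*_; _:^_; _:=_; con)

-- Search over finite types and diameters

Searchable : Set → Set₁
Searchable A = {P : A → Set} → Decidable P → Dec (∃ P)

search-× : ∀ {A B} → Searchable A → Searchable B → Searchable (A × B)
search-× search-A search-B P? =
  map′ (λ (a , b , p) → (a , b) , p) (λ ((a , b) , p) → a , b , p)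
    (search-A λ a → search-B λ b → P? (a , b))

search-Vec : ∀ {k} n → Searchable (Vec (Fin k) n)
search-Vec zero    P? = map′ ([] ,_) (λ { ([] , p) → p }) (P? [])
search-Vec (suc n) P? =
  map′ (λ (x , xs , p) → x ∷ xs , p) (λ { (x ∷ xs , p) → x , xs , p })
    (any? λ x → search-Vec n λ xs → P? (x ∷ xs))

least : ∀ {P : ℕ → Set} → Decidable P → ∀ m → P m →
  ∃[ d ] P d × d ≤ m × (∀ j → P j → d ≤ j)
least P? m p with P? 0
least P? m       p | yes p₀ = 0 , p₀ , z≤n , λ _ _ → z≤n
least P? zero    p | no ¬p₀ = contradiction p ¬p₀
least P? (suc m) p | no ¬p₀ with least (P? ∘ suc) m p
... | d , q , d≤m , minimal = suc d , q , s≤s d≤m , λ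
  { zero    p₀ → contradiction p₀ ¬p₀
  ; (suc j) pⱼ → s≤s (minimal j pⱼ) }

-- The bound `B` is lowered until it is attained; the given element of `Q` keeps it from passing
-- below 0.
greatest : ∀ {A} → Searchable A → {Q : A → Set} → Decidable Q → (f : A → ℕ) →
  ∃ Q → ∀ B → (∀ a → Q a → f a ≤ B) → ∃[ a ] Q a × (∀ b → Q b → f b ≤ f a)
greatest search Q? f (a₀ , q₀) B f≤B with search (λ a → Q? a ×-dec (f a ≟ⁿ B))
... | yes (a , q , refl) = a , q , f≤B
... | no ¬attained with B
...   | zero  = contradiction (a₀ , q₀ , n≤0⇒n≡0 (f≤B a₀ q₀)) ¬attained
...   | suc B = greatest search Q? f (a₀ , q₀) B λ a q →
  s≤s⁻¹ (≤∧≢⇒< (f≤B a q) λ eq → ¬attained (a , q , eq))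

-- Meant for predicates `P i` about the situation after the vertices with `toℕ` below `i` have been
-- treated.
sweep : ∀ n (P : ℕ → Set) → P 0 →
  (∀ (x : Fin n) → P (toℕ x) → P (suc (toℕ x))) → P n
sweep zero    P p₀ step = p₀
sweep (suc n) P p₀ step = sweep n (P ∘ suc) (step zero p₀) (step ∘ suc)

-- Pigeonhole: if every color were attained, a choice of preimages would inject `Fin k` into
-- `Fin m`.
unattained : ∀ {m k} → m < k → (f : Fin m → Fin k) → ∃[ c ] (∀ i → c ≢ f i)
unattained {m} {k} m<k f with any? (λ c → all? λ i → ¬? (c ≟ᶠ f i))
... | yes missing = missing
... | no  ¬missing = contradiction (injective⇒≤ preimage-injective) (<⇒≱ m<k)
  where
  preimage : ∀ c → ∃[ i ] c ≡ f i
  preimage c with any? (λ i → c ≟ᶠ f i)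
  ... | yes p = p
  ... | no ¬p = contradiction (c , λ i eq → ¬p (i , eq)) ¬missing

  preimage-injective : ∀ {c d} → proj₁ (preimage c) ≡ proj₁ (preimage d) → c ≡ d
  preimage-injective {c} {d} eq =
    trans (proj₂ (preimage c)) (trans (cong f eq) (sym (proj₂ (preimage d))))

Joined : {V : Set} → Graph V → V → V → ℕ → Set
Joined G u v m = ∃[ d ] d ≤ m × Walk G u v d

module _ {V : Set} {G : Graph V} where

  _++ʷ_ : ∀ {u v w a b} → Walk G u v a → Walk G v w b → Walk G u w (a + b)
  nil      ++ʷ q = q
  cons e p ++ʷ q = cons e (p ++ʷ q)

  joined-≡ : ∀ {u v m} → u ≡ v → Joined G u v m
  joined-≡ refl = 0 , z≤n , nil

  joined-trans : ∀ {u v w a b} → Joined G u v a → Joined G v w b → Joined G u w (a + b)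
  joined-trans (_ , ≤a , p) (_ , ≤b , q) = _ , +-mono-≤ ≤a ≤b , p ++ʷ q

  joined-weaken : ∀ {u v a b} → a ≤ b → Joined G u v a → Joined G u v b
  joined-weaken a≤b (d , d≤a , p) = d , ≤-trans d≤a a≤b , p

  walk? : Searchable V → (∀ u v → Dec (u ≡ v)) → ∀ u v m → Dec (Walk G u v m)
  walk? search _≟_ u v zero    = map′ (λ { refl → nil }) (λ { nil → refl }) (u ≟ v)
  walk? search _≟_ u v (suc m) =
    map′ (λ (_ , e , p) → cons e p) (λ { (cons e p) → _ , e , p })
      (search λ w → adj? G u w ×-dec walk? search _≟_ w v m)

  -- Walks of a fixed length are decidable by search, so a shortest one exists. Since all distances
  -- are at most `B`, their maximum is attained; `u₀` ensures that there is a pair to start from.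
  diameter : Searchable V → (∀ u v → Dec (u ≡ v)) → V → ∀ B →
    (∀ u v → Joined G u v B) → ∃[ D ] IsDiameter G D × D ≤ B
  diameter search _≟_ u₀ B joined =
    let (u , v) , _ , maximal = greatest (search-× search search) {λ _ → ⊤} (λ _ → yes tt)
          (λ (u , v) → proj₁ (distance u v)) ((u₀ , u₀) , tt) B
          (λ (u , v) _ → proj₂ (proj₂ (distance u v)))
    in proj₁ (distance u v)
     , ( (λ a b → proj₁ (distance a b) , proj₁ (proj₂ (distance a b)) , maximal (a , b) tt)
       , u , v , proj₁ (proj₂ (distance u v)))
     , proj₂ (proj₂ (distance u v))
    where
    distance : ∀ u v → ∃[ d ] IsDistance G u v d × d ≤ B
    distance u v with joined u v
    ... | m , m≤B , p with least (walk? search _≟_ u v) m p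
    ...   | d , q , d≤m , minimal = d , (q , minimal) , ≤-trans d≤m m≤B

-- Recoloring one vertex at a time

module _ {n ℓ : ℕ} {G : Graph (Fin n)} where

  -- refl suffices because ⊥, hence the properness proof, is definitionally irrelevant.
  coloring-≡ : {α β : Coloring G ℓ} → colors α ≡ colors β → α ≡ β
  coloring-≡ refl = refl

  coloring-ext : (α β : Coloring G ℓ) → (∀ v → color α v ≡ color β v) → α ≡ β
  coloring-ext α β eq = coloring-≡ $
    trans (sym (tabulate∘lookup (colors α))) (trans (tabulate-cong eq) (tabulate∘lookup (colors β)))

  _≟ᶜ_ : (α β : Coloring G ℓ) → Dec (α ≡ β)
  α ≟ᶜ β = map′ coloring-≡ (cong colors) (≡ᵛ-dec _≟ᶠ_ (colors α) (colors β))

  search-Coloring : Searchable (Coloring G ℓ)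
  search-Coloring {P} P? = map′
    (λ (c , p , q) → record { colors = c ; proper = p } , q)
    (λ (α , q) → colors α , proper α , q)
    (search-Vec n proper∧P?)
    where
    proper∧P? : ∀ c → Dec (∃[ p ] P (record { colors = c ; proper = p }))
    proper∧P? c with all? (λ u → all? λ v → adj? G u v →-dec ¬? (lookup c u ≟ᶠ lookup c v))
    -- All proofs of properness are definitionally equal to `p`, so deciding `P` at this one proof
    -- decides it at all of them.
    ... | yes p = map′ (p ,_) proj₂ (P? _)
    ... | no ¬p = no (¬p ∘ proj₁)

  fromFunction : (f : Fin n → Fin ℓ) → (∀ u v → Adj G u v → f u ≢ f v) →
    ∃[ α ] (∀ v → color {G = G} α v ≡ f v)
  fromFunction f f-proper =
      record { colors = tabulate f
             ; proper = λ u v e eq → f-proper u v e $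
                 trans (sym (lookup∘tabulate f u)) (trans eq (lookup∘tabulate f v)) }
    , lookup∘tabulate f

  -- By `safe` the set `P` is independent, so an edge has at most one recolored end, and the new
  -- color there avoids the old color of the other end.
  paint : (α : Coloring G ℓ) {P : Fin n → Set} → Decidable P → (c : Fin n → Fin ℓ) →
    (∀ v w → P v → Adj G v w → c v ≢ color α w × ¬ P w) →
    ∃[ γ ] (∀ v → P v → color {G = G} γ v ≡ c v) × (∀ v → ¬ P v → color γ v ≡ color α v)
  paint α {P} P? c safe =
      proj₁ painted
    , (λ v p → trans (proj₂ painted v) (f-in v p))
    , (λ v ¬p → trans (proj₂ painted v) (f-out v ¬p))
    where
    f : Fin n → Fin ℓ
    f v = if does (P? v) then c v else color α v

    f-in : ∀ v → P v → f v ≡ c v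
    f-in v p with P? v
    ... | yes _ = refl
    ... | no ¬p = contradiction p ¬p

    f-out : ∀ v → ¬ P v → f v ≡ color α v
    f-out v ¬p with P? v
    ... | yes p = contradiction p ¬p
    ... | no _  = refl

    f-proper : ∀ u v → Adj G u v → f u ≢ f v
    f-proper u v e with P? u | P? v
    ... | yes p | yes q = contradiction q (proj₂ (safe u v p e))
    ... | yes p | no _  = proj₁ (safe u v p e)
    ... | no _  | yes q = proj₁ (safe v u q (symm G e)) ∘ sym
    ... | no _  | no _  = proper α u v e

    painted = fromFunction f f-proper

  Compatible : Coloring G ℓ → Coloring G ℓ → Set
  Compatible α β = ∀ u v → Adj G u v → color α u ≢ color β v

  -- Adjacency in `R` demands a genuine change, so the walk has length 0 if `x` already has its new
  -- color.
  repaint-joined : (α γ : Coloring G ℓ) (x : Fin n) →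
    (∀ v → v ≢ x → color γ v ≡ color α v) → Joined (R ℓ G) α γ 1
  repaint-joined α γ x same with color α x ≟ᶠ color γ x
  ... | no  differ = 1 , ≤-refl , cons (x , differ , unique) nil
    where
    unique : ∀ {v} → DifferAt α γ v → x ≡ v
    unique {v} d with v ≟ᶠ x
    ... | yes v≡x = sym v≡x
    ... | no  v≢x = contradiction (sym (same v v≢x)) d
  ... | yes agree = joined-≡ (coloring-ext α γ agree-everywhere)
    where
    agree-everywhere : ∀ v → color α v ≡ color γ v
    agree-everywhere v with v ≟ᶠ x
    ... | yes refl = agree
    ... | no  v≢x  = sym (same v v≢x)

  -- Any coloring that takes each of its values from α or β is proper, so the
  -- vertices can be recolored one after another.
  compatible-joined : (α β : Coloring G ℓ) → Compatible α β → Joined (R ℓ G) α β n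
  compatible-joined α β compatible =
    let γ , agree , _ , joined = sweep n State start step
    in subst (λ δ → Joined (R ℓ G) α δ n) (coloring-ext γ β λ v → agree v (toℕ<n v)) joined
    where
    State : ℕ → Set
    State i = ∃[ γ ] (∀ v → toℕ v < i → color γ v ≡ color β v)
      × (∀ v → color γ v ≡ color α v ⊎ color γ v ≡ color β v) × Joined (R ℓ G) α γ i

    start : State 0
    start = α , (λ _ ()) , (λ _ → inj₁ refl) , joined-≡ refl

    step : ∀ x → State (toℕ x) → State (suc (toℕ x))
    step x (γ , agree , mixed , joined) =
        γ′ , agree′ , mixed′
      , joined-weaken (≤-reflexive (+-comm (toℕ x) 1))
          (joined-trans joined (repaint-joined γ γ′ x outside))
      where
      safe : ∀ v w → v ≡ x → Adj G v w → color β v ≢ color γ w × w ≢ x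
      safe v w refl e = β≢γ , λ { refl → irrefl G e }
        where
        β≢γ : color β v ≢ color γ w
        β≢γ eq with mixed w
        ... | inj₁ γ≡α = compatible w v (symm G e) (sym (trans eq γ≡α))
        ... | inj₂ γ≡β = proper β v w e (trans eq γ≡β)

      painted = paint γ (_≟ᶠ x) (color β) safe
      γ′      = proj₁ painted
      inside  = proj₁ (proj₂ painted)
      outside = proj₂ (proj₂ painted)

      agree′ : ∀ v → toℕ v < suc (toℕ x) → color γ′ v ≡ color β v
      agree′ v v≤x with v ≟ᶠ x
      ... | yes v≡x = inside v v≡x
      ... | no  v≢x = trans (outside v v≢x) (agree v (≤∧≢⇒< (s≤s⁻¹ v≤x) (v≢x ∘ toℕ-injective)))

      mixed′ : ∀ v → color γ′ v ≡ color α v ⊎ color γ′ v ≡ color β v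
      mixed′ v with v ≟ᶠ x
      ... | yes v≡x = inj₂ (inside v v≡x)
      ... | no  v≢x = [ inj₁ ∘ trans (outside v v≢x) , inj₂ ∘ trans (outside v v≢x) ]′ (mixed v)

  -- Applied to colorings of the core, so that `pull-joined` turns a simultaneous recoloring there
  -- into at most `n` single steps in the whole graph.
  painted-compatible : (α γ : Coloring G ℓ) {P : Fin n → Set} → Decidable P → (c : Fin n → Fin ℓ) →
    (∀ v w → P v → Adj G v w → c v ≢ color α w) →
    (∀ v → P v → color γ v ≡ c v) → (∀ v → ¬ P v → color γ v ≡ color α v) → Compatible α γ
  painted-compatible α γ P? c safe inside outside u v e eq with P? v
  ... | yes p = safe v u p (symm G e) (sym (trans eq (inside v p)))
  ... | no ¬p = proper α u v e (trans eq (outside v ¬p))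

-- Recoloring through a retraction

-- No coloring of `H` has a frozen vertex: each vertex can change its color while all others keep
-- theirs.
Dodgeable : ∀ {k} → Graph (Fin k) → ℕ → Set
Dodgeable H ℓ = ∀ (γ : Coloring H ℓ) i →
  ∃[ c ] c ≢ color γ i × (∀ j → Adj H i j → c ≢ color γ j)

-- The field `dominated` says that the neighborhood of `w` is contained in that of its image
-- `embed (retract w)`, which is why `w` may take the color of that image.
record Retraction {n k : ℕ} (G : Graph (Fin n)) (H : Graph (Fin k)) : Set where
  field
    embed         : Fin k → Fin n
    retract       : Fin n → Fin k
    retract-embed : ∀ i → retract (embed i) ≡ i
    embed-adj     : ∀ {i j} → Adj H i j → Adj G (embed i) (embed j)
    retract-adj   : ∀ {v w} → Adj G v w → Adj H (retract v) (retract w)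
    dominated     : ∀ {v w} → Adj G v w → Adj G v (embed (retract w))

  embed-injective : ∀ {i j} → embed i ≡ embed j → i ≡ j
  embed-injective {i} {j} eq =
    trans (sym (retract-embed i)) (trans (cong retract eq) (retract-embed j))

  k≤n : k ≤ n
  k≤n = injective⇒≤ embed-injective

  -- A vertex that is moved lies outside the image of `embed`, so it extends `embed` to an injection
  -- from `Fin (suc k)`.
  k<n : ∀ {v} → embed (retract v) ≢ v → k < n
  k<n {v} v-moves = injective⇒≤ extended-injective
    where
    extended : Fin (suc k) → Fin n
    extended zero    = v
    extended (suc i) = embed i

    v∉embed : ∀ i → v ≢ embed i
    v∉embed i refl = v-moves (cong embed (retract-embed i))

    extended-injective : ∀ {i j} → extended i ≡ extended j → i ≡ j
    extended-injective {zero}  {zero}  _  = refl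
    extended-injective {zero}  {suc j} eq = contradiction eq (v∉embed j)
    extended-injective {suc i} {zero}  eq = contradiction (sym eq) (v∉embed i)
    extended-injective {suc i} {suc j} eq = cong suc (embed-injective eq)

  module _ {ℓ : ℕ} where

    pulled : (γ : Coloring H ℓ) → ∃[ α ] (∀ v → color {G = G} α v ≡ color γ (retract v))
    pulled γ = fromFunction (color γ ∘ retract) λ u v e →
      proper γ (retract u) (retract v) (retract-adj e)

    pull : Coloring H ℓ → Coloring G ℓ
    pull γ = proj₁ (pulled γ)

    color-pull : ∀ γ v → color (pull γ) v ≡ color γ (retract v)
    color-pull γ = proj₂ (pulled γ)

    restricted : (α : Coloring G ℓ) → ∃[ γ ] (∀ i → color {G = H} γ i ≡ color α (embed i))
    restricted α = fromFunction (color α ∘ embed) λ i j e →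
      proper α (embed i) (embed j) (embed-adj e)

    restrict : Coloring G ℓ → Coloring H ℓ
    restrict α = proj₁ (restricted α)

    color-pull-restrict : ∀ α v → color (pull (restrict α)) v ≡ color α (embed (retract v))
    color-pull-restrict α v =
      trans (color-pull (restrict α) v) (proj₂ (restricted α) (retract v))

    pull-joined : (γ δ : Coloring H ℓ) → Compatible γ δ → Joined (R ℓ G) (pull γ) (pull δ) n
    pull-joined γ δ compatible = compatible-joined (pull γ) (pull δ) λ u v e eq →
      compatible (retract u) (retract v) (retract-adj e)
        (trans (sym (color-pull γ u)) (trans eq (color-pull δ v)))

    -- For an edge uv, `dominated` makes `u` adjacent to the image of `v`, so `α` itself separates
    -- the two colors to be compared.
    fold : ∀ α → Joined (R ℓ G) α (pull (restrict α)) n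
    fold α = compatible-joined α (pull (restrict α)) λ u v e eq →
      proper α u (embed (retract v)) (dominated e) (trans eq (color-pull-restrict α v))

    unfold : ∀ α → Joined (R ℓ G) (pull (restrict α)) α n
    unfold α = compatible-joined (pull (restrict α)) α λ u v e eq →
      proper α v (embed (retract u)) (dominated (symm G e))
        (sym (trans (sym (color-pull-restrict α u)) eq))

    -- The vertices x of H receive their final colors one after another.  First
    -- all neighbors of x that have the final color of x change to another
    -- color; they form an independent set and have not been treated before.
    pulls-joined : Dodgeable H ℓ → ∀ α β → Joined (R ℓ G) (pull α) (pull β) (k * (n + n))
    pulls-joined dodge α β =
      let γ , agree , joined = sweep k State start step
      in subst (λ δ → Joined (R ℓ G) (pull α) (pull δ) (k * (n + n)))
           (coloring-ext γ β λ v → agree v (toℕ<n v)) joined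
      where
      State : ℕ → Set
      State i = ∃[ γ ] (∀ j → toℕ j < i → color γ j ≡ color β j)
        × Joined (R ℓ G) (pull α) (pull γ) (i * (n + n))

      start : State 0
      start = α , (λ _ ()) , joined-≡ refl

      step : ∀ x → State (toℕ x) → State (suc (toℕ x))
      step x (γ , agree , joined) =
          ε , agree′
        , joined-weaken (≤-reflexive (+-comm (toℕ x * (n + n)) (n + n)))
            (joined-trans joined (joined-trans
              (pull-joined γ δ (painted-compatible γ δ P? c
                (λ v w p e → proj₁ (safe v w p e)) δ-in δ-out))
              (pull-joined δ ε (painted-compatible δ ε (_≟ᶠ x) (color β)
                (λ v w p e → proj₁ (safe′ v w p e)) ε-in ε-out))))
        where
        P : Fin k → Set
        P y = Adj H x y × color γ y ≡ color β x

        P? : Decidable P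
        P? y = adj? H x y ×-dec (color γ y ≟ᶠ color β x)

        c : Fin k → Fin ℓ
        c y = proj₁ (dodge γ y)

        -- Two vertices of `P` share the color `color β x`, so they cannot be adjacent.
        safe : ∀ v w → P v → Adj H v w → c v ≢ color γ w × ¬ P w
        safe v w (_ , γv) e =
          proj₂ (proj₂ (dodge γ v)) w e , λ (_ , γw) → proper γ v w e (trans γv (sym γw))

        δ-painted = paint γ P? c safe
        δ     = proj₁ δ-painted
        δ-in  = proj₁ (proj₂ δ-painted)
        δ-out = proj₂ (proj₂ δ-painted)

        vacated : ∀ w → Adj H x w → color β x ≢ color δ w
        vacated w e eq with P? w
        ... | yes p@(_ , γw) =
          proj₁ (proj₂ (dodge γ w)) (trans (sym (δ-in w p)) (trans (sym eq) (sym γw)))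
        ... | no ¬p = ¬p (e , trans (sym (δ-out w ¬p)) (sym eq))

        safe′ : ∀ v w → v ≡ x → Adj H v w → color β v ≢ color δ w × w ≢ x
        safe′ v w refl e = vacated w e , λ { refl → irrefl H e }

        ε-painted = paint δ (_≟ᶠ x) (color β) safe′
        ε     = proj₁ ε-painted
        ε-in  = proj₁ (proj₂ ε-painted)
        ε-out = proj₂ (proj₂ ε-painted)

        agree′ : ∀ j → toℕ j < suc (toℕ x) → color ε j ≡ color β j
        agree′ j j≤x with j ≟ᶠ x
        ... | yes j≡x = ε-in j j≡x
        ... | no  j≢x = trans (ε-out j j≢x) (trans (δ-out j ¬p) γ≡β)
          where
          γ≡β : color γ j ≡ color β j
          γ≡β = agree j (≤∧≢⇒< (s≤s⁻¹ j≤x) (j≢x ∘ toℕ-injective))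

          -- A treated neighbor of `x` has its `β`-color, which differs from that of `x`, so it does
          -- not have to move aside.
          ¬p : ¬ P j
          ¬p (e , γ≡βx) = proper β x j e (trans (sym γ≡βx) γ≡β)

    joined : Dodgeable H ℓ → ∀ α β → Joined (R ℓ G) α β (2 * n ^ 2)
    joined dodge α β with any? (λ v → ¬? (embed (retract v) ≟ᶠ v))
    -- Here k + 1 ≤ n, so the 2n steps of `fold` and `unfold` fit: 2nk + 2n = 2n(k + 1) ≤ 2n².
    ... | yes (v , v-moves) = joined-weaken bound
      (joined-trans (fold α) (joined-trans (pulls-joined dodge (restrict α) (restrict β)) (unfold β)))
      where
      bound : n + (k * (n + n) + n) ≤ 2 * n ^ 2
      bound = ≤-trans (≤-reflexive (solve 2 (λ k n →
          n :+ (k :* (n :+ n) :+ n) := (con 1 :+ k) :* (n :+ n)) refl k n))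
        (≤-trans (*-monoˡ-≤ (n + n) (k<n v-moves))
          (≤-reflexive (solve 1 (λ n → n :* (n :+ n) := con 2 :* n :^ 2) refl n)))
    -- Every vertex is its own image, so `pull (restrict α)` is `α` and the 2nk steps in the middle
    -- suffice.
    ... | no fixed = joined-weaken bound
      (subst (λ γ → Joined (R ℓ G) γ β (k * (n + n))) (pull-restrict α)
        (subst (λ γ → Joined (R ℓ G) (pull (restrict α)) γ (k * (n + n))) (pull-restrict β)
          (pulls-joined dodge (restrict α) (restrict β))))
      where
      pull-restrict : ∀ α → pull (restrict α) ≡ α
      pull-restrict α = coloring-ext (pull (restrict α)) α λ v → trans (color-pull-restrict α v) (fixes v)
        where
        fixes : ∀ v → color α (embed (retract v)) ≡ color α v
        fixes v with embed (retract v) ≟ᶠ v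
        ... | yes eq = cong (color α) eq
        ... | no  neq = contradiction (v , neq) fixed

      bound : k * (n + n) ≤ 2 * n ^ 2
      bound = ≤-trans (*-monoˡ-≤ (n + n) k≤n)
        (≤-reflexive (solve 1 (λ n → n :* (n :+ n) := con 2 :* n :^ 2) refl n))

-- Structure of (2K₂, paw)-free graphs

module _ {n : ℕ} {G : Graph (Fin n)} where

  private
    infix 4 _~_
    _~_ = Adj G

  adj-≢ : ∀ {u v} → u ~ v → u ≢ v
  adj-≢ e refl = irrefl G e

  -- Decidable adjacency turns the forbidden subgraph into a positive disjunction. Edges that share
  -- a vertex are covered too.
  2K₂-free-touch : 2K₂ -Free G → ∀ {a b c d} → a ~ b → c ~ d →
    (a ~ c ⊎ a ~ d) ⊎ (b ~ c ⊎ b ~ d)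
  2K₂-free-touch free {a} {b} {c} {d} ab cd = decidable-stable
    ((adj? G a c ⊎-dec adj? G a d) ⊎-dec (adj? G b c ⊎-dec adj? G b d)) λ apart →
      free (induced (apart ∘ inj₁ ∘ inj₁) (apart ∘ inj₁ ∘ inj₂)
                    (apart ∘ inj₂ ∘ inj₁) (apart ∘ inj₂ ∘ inj₂))
    where
    induced : ¬ a ~ c → ¬ a ~ d → ¬ b ~ c → ¬ b ~ d → InducedEmbedding 2K₂ G
    induced ¬ac ¬ad ¬bc ¬bd = record
      { to        = to
      ; injective = λ {u} {v} → to-injective u v
      ; adj-iff   = λ u v → mk⇔ (adj u v) (adj⁻¹ u v) }
      where
      to : Fin 2 ⊎ Fin 2 → Fin n
      to (inj₁ 0F) = a
      to (inj₁ 1F) = b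
      to (inj₂ 0F) = c
      to (inj₂ 1F) = d

      separate : ∀ i j → ¬ to (inj₁ i) ~ to (inj₂ j)
      separate 0F 0F = ¬ac
      separate 0F 1F = ¬ad
      separate 1F 0F = ¬bc
      separate 1F 1F = ¬bd

      mate : ∀ j → ∃[ k ] to (inj₂ j) ~ to (inj₂ k)
      mate 0F = 1F , cd
      mate 1F = 0F , symm G cd

      -- A common vertex of the two edges would be adjacent to its mate in cd, against `separate`.
      distinct : ∀ i j → to (inj₁ i) ≢ to (inj₂ j)
      distinct i j eq = let k , e = mate j in separate i k (subst (_~ _) (sym eq) e)

      to-injective : ∀ u v → to u ≡ to v → u ≡ v
      to-injective (inj₁ 0F) (inj₁ 0F) eq = refl
      to-injective (inj₁ 0F) (inj₁ 1F) eq = contradiction eq (adj-≢ ab)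
      to-injective (inj₁ 1F) (inj₁ 0F) eq = contradiction (sym eq) (adj-≢ ab)
      to-injective (inj₁ 1F) (inj₁ 1F) eq = refl
      to-injective (inj₁ i)  (inj₂ j)  eq = contradiction eq (distinct i j)
      to-injective (inj₂ i)  (inj₁ j)  eq = contradiction (sym eq) (distinct j i)
      to-injective (inj₂ 0F) (inj₂ 0F) eq = refl
      to-injective (inj₂ 0F) (inj₂ 1F) eq = contradiction eq (adj-≢ cd)
      to-injective (inj₂ 1F) (inj₂ 0F) eq = contradiction (sym eq) (adj-≢ cd)
      to-injective (inj₂ 1F) (inj₂ 1F) eq = refl

      adj : ∀ u v → Adj 2K₂ u v → to u ~ to v
      adj _ _ (left  {0F} {0F} i≢i) = contradiction refl i≢i
      adj _ _ (left  {0F} {1F} _)   = ab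
      adj _ _ (left  {1F} {0F} _)   = symm G ab
      adj _ _ (left  {1F} {1F} i≢i) = contradiction refl i≢i
      adj _ _ (right {0F} {0F} i≢i) = contradiction refl i≢i
      adj _ _ (right {0F} {1F} _)   = cd
      adj _ _ (right {1F} {0F} _)   = symm G cd
      adj _ _ (right {1F} {1F} i≢i) = contradiction refl i≢i

      adj⁻¹ : ∀ u v → to u ~ to v → Adj 2K₂ u v
      adj⁻¹ (inj₁ i) (inj₁ j) e = left  λ { refl → irrefl G e }
      adj⁻¹ (inj₁ i) (inj₂ j) e = contradiction e (separate i j)
      adj⁻¹ (inj₂ i) (inj₁ j) e = contradiction (symm G e) (separate j i)
      adj⁻¹ (inj₂ i) (inj₂ j) e = right λ { refl → irrefl G e }

  -- So a vertex that sees some vertex of a triangle misses at most one of the three. If `d` is `b`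
  -- or `c`, the edge bc itself gives the conclusion.
  paw-free-touch : paw -Free G → ∀ {a b c d} → a ~ b → a ~ c → b ~ c → d ~ a → d ~ b ⊎ d ~ c
  paw-free-touch free {a} {b} {c} {d} ab ac bc da = decidable-stable
    (adj? G d b ⊎-dec adj? G d c) λ apart → free (induced (apart ∘ inj₁) (apart ∘ inj₂))
    where
    induced : ¬ d ~ b → ¬ d ~ c → InducedEmbedding paw G
    induced ¬db ¬dc = record
      { to        = to
      ; injective = λ {u} {v} → to-injective u v
      ; adj-iff   = λ u v → mk⇔ adj (adj⁻¹ u v) }
      where
      to : _ → Fin n
      to nothing   = d
      to (just 0F) = a
      to (just 1F) = b
      to (just 2F) = c

      d∉triangle : ∀ i → d ≢ to (just i)
      d∉triangle 0F = adj-≢ da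
      d∉triangle 1F refl = ¬dc bc
      d∉triangle 2F refl = ¬db (symm G bc)

      to-injective : ∀ u v → to u ≡ to v → u ≡ v
      to-injective nothing   nothing   eq = refl
      to-injective nothing   (just j)  eq = contradiction eq (d∉triangle j)
      to-injective (just i)  nothing   eq = contradiction (sym eq) (d∉triangle i)
      to-injective (just 0F) (just 0F) eq = refl
      to-injective (just 0F) (just 1F) eq = contradiction eq (adj-≢ ab)
      to-injective (just 0F) (just 2F) eq = contradiction eq (adj-≢ ac)
      to-injective (just 1F) (just 0F) eq = contradiction (sym eq) (adj-≢ ab)
      to-injective (just 1F) (just 1F) eq = refl
      to-injective (just 1F) (just 2F) eq = contradiction eq (adj-≢ bc)
      to-injective (just 2F) (just 0F) eq = contradiction (sym eq) (adj-≢ ac)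
      to-injective (just 2F) (just 1F) eq = contradiction (sym eq) (adj-≢ bc)
      to-injective (just 2F) (just 2F) eq = refl

      adj : ∀ {u v} → PawAdj u v → to u ~ to v
      adj pendantˡ = da
      adj pendantʳ = symm G da
      adj (triangle {0F} {0F} i≢i) = contradiction refl i≢i
      adj (triangle {0F} {1F} _)   = ab
      adj (triangle {0F} {2F} _)   = ac
      adj (triangle {1F} {0F} _)   = symm G ab
      adj (triangle {1F} {1F} i≢i) = contradiction refl i≢i
      adj (triangle {1F} {2F} _)   = bc
      adj (triangle {2F} {0F} _)   = symm G ac
      adj (triangle {2F} {1F} _)   = symm G bc
      adj (triangle {2F} {2F} i≢i) = contradiction refl i≢i

      adj⁻¹ : ∀ u v → to u ~ to v → PawAdj u v
      adj⁻¹ nothing   nothing   e = contradiction e (irrefl G)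
      adj⁻¹ nothing   (just 0F) e = pendantˡ
      adj⁻¹ nothing   (just 1F) e = contradiction e ¬db
      adj⁻¹ nothing   (just 2F) e = contradiction e ¬dc
      adj⁻¹ (just 0F) nothing   e = pendantʳ
      adj⁻¹ (just 1F) nothing   e = contradiction (symm G e) ¬db
      adj⁻¹ (just 2F) nothing   e = contradiction (symm G e) ¬dc
      adj⁻¹ (just i)  (just j)  e = triangle λ { refl → irrefl G e }

-- Complete graphs and the 5-cycle as cores

complete-coloring-≤ : ∀ {k ℓ} → Coloring (complete k) ℓ → k ≤ ℓ
complete-coloring-≤ γ = injective⇒≤ λ {i} {j} eq →
  decidable-stable (i ≟ᶠ j) λ i≢j → proper γ i j i≢j eq

complete-dodgeable : ∀ {k ℓ} → k < ℓ → Dodgeable (complete k) ℓ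
complete-dodgeable k<ℓ γ i =
  let c , fresh = unattained k<ℓ (color γ) in c , fresh i , λ j _ → fresh j

next : Fin 5 → Fin 5
next 0F = 1F
next 1F = 2F
next 2F = 3F
next 3F = 4F
next 4F = 0F

-- Written as a power of `next`, so that `prev (next i)` and `next (prev i)` are definitionally
-- equal and `next-prev` serves for both.
prev : Fin 5 → Fin 5
prev = next ∘ next ∘ next ∘ next

next-prev : ∀ i → next (prev i) ≡ i
next-prev 0F = refl
next-prev 1F = refl
next-prev 2F = refl
next-prev 3F = refl
next-prev 4F = refl

next-≢ : ∀ i → i ≢ next i
next-≢ 0F ()
next-≢ 1F ()
next-≢ 2F ()
next-≢ 3F ()
next-≢ 4F ()

-- The difference of two positions modulo 5, as a view that expresses one position through the
-- other.
data Position : Fin 5 → Fin 5 → Set where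
  same   : ∀ {i} → Position i i
  ahead₁ : ∀ {i} → Position i (next i)
  ahead₂ : ∀ {i} → Position i (next (next i))
  back₁  : ∀ {i} → Position (next i) i
  back₂  : ∀ {i} → Position (next (next i)) i

position : ∀ i j → Position i j
position 0F 0F = same
position 0F 1F = ahead₁
position 0F 2F = ahead₂
position 0F 3F = back₂
position 0F 4F = back₁
position 1F 0F = back₁
position 1F 1F = same
position 1F 2F = ahead₁
position 1F 3F = ahead₂
position 1F 4F = back₂
position 2F 0F = back₂
position 2F 1F = back₁
position 2F 2F = same
position 2F 3F = ahead₁
position 2F 4F = ahead₂
position 3F 0F = ahead₂
position 3F 1F = back₂
position 3F 2F = back₁
position 3F 3F = same
position 3F 4F = ahead₁
position 4F 0F = ahead₁
position 4F 1F = ahead₂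
position 4F 2F = back₂
position 4F 3F = back₁
position 4F 4F = same

C₅ : Graph (Fin 5)
C₅ = record
  { Adj    = λ i j → j ≡ next i ⊎ i ≡ next j
  ; adj?   = λ i j → (j ≟ᶠ next i) ⊎-dec (i ≟ᶠ next j)
  ; symm   = [ inj₂ , inj₁ ]′
  ; irrefl = λ {i} → [ next-≢ i , next-≢ i ]′
  }

distinct⇒3≤ : ∀ {k} {x y z : Fin k} → x ≢ y → x ≢ z → y ≢ z → 3 ≤ k
distinct⇒3≤ {x = x} {y} {z} x≢y x≢z y≢z =
  injective⇒≤ {f = lookup (x ∷ y ∷ z ∷ [])} λ {i} {j} → lookup-injective i j
  where
  lookup-injective : ∀ i j → lookup (x ∷ y ∷ z ∷ []) i ≡ lookup (x ∷ y ∷ z ∷ []) j → i ≡ j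
  lookup-injective 0F 0F eq = refl
  lookup-injective 0F 1F eq = contradiction eq x≢y
  lookup-injective 0F 2F eq = contradiction eq x≢z
  lookup-injective 1F 0F eq = contradiction (sym eq) x≢y
  lookup-injective 1F 1F eq = refl
  lookup-injective 1F 2F eq = contradiction eq y≢z
  lookup-injective 2F 0F eq = contradiction (sym eq) x≢z
  lookup-injective 2F 1F eq = contradiction (sym eq) y≢z
  lookup-injective 2F 2F eq = refl

-- If 0 and 2 differ in color, then 0, 1, 2 have three colors. Otherwise 4, a neighbor of 0, also
-- differs from 2, and 2, 3, 4 have three colors.
C₅-coloring-≤ : ∀ {ℓ} → Coloring C₅ ℓ → 3 ≤ ℓ
C₅-coloring-≤ γ with color γ 0F ≟ᶠ color γ 2F
... | no  γ₀≢γ₂ = distinct⇒3≤ (proper γ 0F 1F (inj₁ refl)) γ₀≢γ₂ (proper γ 1F 2F (inj₁ refl))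
... | yes γ₀≡γ₂ = distinct⇒3≤ (proper γ 2F 3F (inj₁ refl))
  (λ γ₂≡γ₄ → proper γ 0F 4F (inj₂ refl) (trans γ₀≡γ₂ γ₂≡γ₄)) (proper γ 3F 4F (inj₁ refl))

-- A vertex and its two neighbors occupy at most three colors.
C₅-dodgeable : ∀ {ℓ} → 3 < ℓ → Dodgeable C₅ ℓ
C₅-dodgeable 3<ℓ γ i =
  let c , fresh = unattained 3<ℓ (lookup (color γ i ∷ color γ (next i) ∷ color γ (prev i) ∷ []))
  in c , fresh 0F , λ
    { j (inj₁ refl) → fresh 1F
    ; j (inj₂ refl) → subst (λ m → c ≢ color γ m) (next-prev j) (fresh 2F) }

-- The field `dodgeable` asks for a coloring of `H` with `χ` colors because a coloring of `G`
-- restricts to one; it forces `χ` to be at least the size of a complete `H`, and at least 3 for the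
-- 5-cycle.
record Core {n : ℕ} (G : Graph (Fin n)) : Set₁ where
  field
    {k}        : ℕ
    H          : Graph (Fin k)
    retraction : Retraction G H
    dodgeable  : ∀ {χ ℓ} → Coloring H χ → χ < ℓ → Dodgeable H ℓ

  open Retraction retraction public

complete-core : ∀ {n k} {G : Graph (Fin n)} → Retraction G (complete k) → Core G
complete-core retraction = record
  { retraction = retraction
  ; dodgeable  = λ γ χ<ℓ → complete-dodgeable (≤-trans (s≤s (complete-coloring-≤ γ)) χ<ℓ)
  }

C₅-core : ∀ {n} {G : Graph (Fin n)} → Retraction G C₅ → Core G
C₅-core retraction = record
  { retraction = retraction
  ; dodgeable  = λ γ χ<ℓ → C₅-dodgeable (≤-trans (s≤s (C₅-coloring-≤ γ)) χ<ℓ)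
  }

edgeless-core : ∀ {n} (G : Graph (Fin n)) → (∀ u v → ¬ Adj G u v) → Core G
edgeless-core {zero} G edgeless = complete-core {k = 0} record
  { embed         = λ ()
  ; retract       = λ ()
  ; retract-embed = λ ()
  ; embed-adj     = λ {}
  ; retract-adj   = λ {}
  ; dominated     = λ {}
  }
edgeless-core {suc n} G edgeless = complete-core {k = 1} record
  { embed         = λ _ → zero
  ; retract       = λ _ → zero
  ; retract-embed = λ { 0F → refl }
  ; embed-adj     = λ { {0F} {0F} 0≢0 → contradiction refl 0≢0 }
  ; retract-adj   = λ {v} {w} e → contradiction e (edgeless v w)
  ; dominated     = λ {v} {w} e → contradiction e (edgeless v w)
  }

Triangle Pentagon : ∀ {n} → Graph (Fin n) → Set
Triangle G = ∃[ a ] ∃[ b ] ∃[ c ] Adj G a b × Adj G a c × Adj G b c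
-- In a triangle-free graph such a closed walk is automatically an induced 5-cycle.
Pentagon {n} G = Σ (Vec (Fin n) 5) λ c → ∀ i → Adj G (lookup c i) (lookup c (next i))

module _ {n : ℕ} (G : Graph (Fin n)) where

  private
    infix 4 _~_
    _~_ = Adj G

  triangle? : Dec (Triangle G)
  triangle? = any? λ a → any? λ b → any? λ c → adj? G a b ×-dec adj? G a c ×-dec adj? G b c

  pentagon? : Dec (Pentagon G)
  pentagon? = search-Vec 5 λ c → all? λ i → adj? G (lookup c i) (lookup c (next i))

  -- Graphs with a triangle: retraction onto a maximal clique

  Clique : ∀ {k} → (Fin k → Fin n) → Set
  Clique e = ∀ i j → i ≢ j → e i ~ e j

  -- The missed index is part of the data since it becomes the value of the retraction at `v`.
  Maximal : ∀ {k} → (Fin k → Fin n) → Set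
  Maximal e = ∀ v → ∃[ i ] ¬ v ~ e i

  clique-≤ : ∀ {k} {e : Fin k → Fin n} → Clique e → k ≤ n
  clique-≤ {e = e} clique = injective⇒≤ {f = e} λ {i} {j} eq →
    decidable-stable (i ≟ᶠ j) λ i≢j → adj-≢ {G = G} (clique i j i≢j) eq

  -- Greedy extension. The sum of fuel and clique size stays above `n`, so by `clique-≤` the fuel
  -- cannot run out.
  maximal-clique : ∀ fuel m (e : Fin (3 + m) → Fin n) → Clique e → n < fuel + (3 + m) →
    ∃[ m′ ] Σ (Fin (3 + m′) → Fin n) λ e′ → Clique e′ × Maximal e′
  maximal-clique zero       m e clique n< = contradiction (clique-≤ clique) (<⇒≱ n<)
  maximal-clique (suc fuel) m e clique n< with any? (λ v → all? λ i → adj? G v (e i))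
  ... | no  ¬extends = m , e , clique , λ v →
    ¬∀⟶∃¬ _ _ (λ i → adj? G v (e i)) (λ all → ¬extends (v , all))
  ... | yes (v , v~e) = maximal-clique fuel (suc m) e′ clique′
      (subst (n <_) (sym (+-suc fuel (3 + m))) n<)
    where
    e′ : Fin (4 + m) → Fin n
    e′ zero    = v
    e′ (suc i) = e i

    clique′ : Clique e′
    clique′ zero    zero    0≢0 = contradiction refl 0≢0
    clique′ zero    (suc j) _   = v~e j
    clique′ (suc i) zero    _   = symm G (v~e i)
    clique′ (suc i) (suc j) i≢j = clique i j (i≢j ∘ cong suc)

  module _ (2K₂-free : 2K₂ -Free G) (paw-free : paw -Free G) where

    -- Each vertex is sent to a clique vertex that it misses. A non-isolated vertex misses only that
    -- one, and adjacent vertices miss different ones.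
    clique-retraction : ∀ {m} (e : Fin (3 + m) → Fin n) → Clique e → Maximal e →
      Retraction G (complete (3 + m))
    clique-retraction {m} e clique maximal = record
      { embed         = e
      ; retract       = r
      ; retract-embed = λ i → decidable-stable (r (e i) ≟ᶠ i) λ ri≢i →
          proj₂ (maximal (e i)) (clique i (r (e i)) (ri≢i ∘ sym))
      ; embed-adj     = λ {i} {j} → clique i j
      ; retract-adj   = r-adj
      ; dominated     = λ vw → sees vw (r-adj vw ∘ sym)
      }
      where
      r : Fin n → Fin (3 + m)
      r v = proj₁ (maximal v)

      -- Otherwise `w` would see a second vertex of the triangle, and `v`, attached through `w` to
      -- the triangle so formed, would have to see one of the two.
      unseen-neighbor : ∀ {v w x y z} → x ~ y → x ~ z → y ~ z → ¬ v ~ x → ¬ v ~ y → ¬ v ~ z →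
        v ~ w → ¬ w ~ x
      unseen-neighbor xy xz yz ¬vx ¬vy ¬vz vw wx =
        [ (λ wy → [ ¬vx , ¬vy ]′ (paw-free-touch paw-free wx wy xy vw))
        , (λ wz → [ ¬vx , ¬vz ]′ (paw-free-touch paw-free wx wz xz vw))
        ]′ (paw-free-touch paw-free xy xz yz wx)

      -- If `v` saw no clique vertex, then by `unseen-neighbor` its neighbor `w` would miss `e 0F`
      -- and `e 1F`, and the edge between these would form a 2K₂ with vw.
      sees-some : ∀ {v w} → v ~ w → ∃[ i ] v ~ e i
      sees-some {v} {w} vw = decidable-stable (any? λ i → adj? G v (e i)) λ none →
        let unseen : ∀ i → ¬ v ~ e i
            unseen i ve = none (i , ve)
            e₀₁ = clique 0F 1F λ ()
            e₀₂ = clique 0F 2F λ ()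
            e₁₂ = clique 1F 2F λ ()
        in [ [ unseen 0F , unseen 1F ]′
           , [ unseen-neighbor e₀₁ e₀₂ e₁₂ (unseen 0F) (unseen 1F) (unseen 2F) vw
             , unseen-neighbor (symm G e₀₁) e₁₂ e₀₂ (unseen 1F) (unseen 0F) (unseen 2F) vw
             ]′
           ]′ (2K₂-free-touch 2K₂-free vw e₀₁)

      -- Let `v` see `e y`. In the triangle of `e y`, `e (r v)` and `e j` it misses `e (r v)`, so it
      -- sees `e j`.
      sees : ∀ {v w j} → v ~ w → j ≢ r v → v ~ e j
      sees {v} {w} {j} vw j≢rv with sees-some vw
      ... | y , vy with y ≟ᶠ j
      ...   | yes refl = vy
      ...   | no  y≢j  = [ (λ v~er → contradiction v~er (proj₂ (maximal v))) , (λ v~ej → v~ej) ]′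
        (paw-free-touch paw-free (clique y (r v) λ { refl → proj₂ (maximal v) vy })
          (clique y j y≢j) (clique (r v) j (j≢rv ∘ sym)) vy)

      other : (i : Fin (3 + m)) → ∃[ j ] j ≢ i
      other zero    = 1F , λ ()
      other (suc i) = 0F , λ ()

      -- If both missed the same clique vertex, any other clique vertex `e j` would form a triangle
      -- with `v` and `w`, and the missed one, attached at `e j`, would make a paw.
      r-adj : ∀ {v w} → v ~ w → r v ≢ r w
      r-adj {v} {w} vw rv≡rw with other (r v)
      ... | j , j≢rv =
        [ proj₂ (maximal v) ∘ symm G
        , (λ rv~w → proj₂ (maximal w) (subst (λ i → w ~ e i) rv≡rw (symm G rv~w)))
        ]′ (paw-free-touch paw-free (symm G (sees vw j≢rv))
             (symm G (sees (symm G vw) (λ j≡rw → j≢rv (trans j≡rw (sym rv≡rw))))) vw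
             (clique (r v) j (j≢rv ∘ sym)))

    triangle-core : Triangle G → Core G
    triangle-core (a , b , c , ab , ac , bc) =
      let _ , e , clique , maximal = maximal-clique n 0 abc abc-clique n<n+3
      in complete-core (clique-retraction e clique maximal)
      where
      abc : Fin 3 → Fin n
      abc = lookup (a ∷ b ∷ c ∷ [])

      abc-clique : Clique abc
      abc-clique 0F 0F i≢i = contradiction refl i≢i
      abc-clique 0F 1F _   = ab
      abc-clique 0F 2F _   = ac
      abc-clique 1F 0F _   = symm G ab
      abc-clique 1F 1F i≢i = contradiction refl i≢i
      abc-clique 1F 2F _   = bc
      abc-clique 2F 0F _   = symm G ac
      abc-clique 2F 1F _   = symm G bc
      abc-clique 2F 2F i≢i = contradiction refl i≢i

      n<n+3 : n < n + 3
      n<n+3 = ≤-trans (≤-reflexive (+-comm 1 n)) (+-mono-≤ {n} ≤-refl (s≤s z≤n))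

  -- Triangle-free graphs with a 5-cycle

  module _ (2K₂-free : 2K₂ -Free G) (triangle-free : ¬ Triangle G) where

    no-triangle : ∀ {a b c} → a ~ b → a ~ c → ¬ b ~ c
    no-triangle ab ac bc = triangle-free (_ , _ , _ , ab , ac , bc)

    pentagon-core : Pentagon G → Core G
    pentagon-core (cycle , edge) = C₅-core record
      { embed         = c
      ; retract       = r
      ; retract-embed = λ i → sits-unique i (r-sits (edge i))
      ; embed-adj     = λ { (inj₁ refl) → edge _ ; (inj₂ refl) → symm G (edge _) }
      ; retract-adj   = λ vw → sits-adj vw (r-sits vw) (r-sits (symm G vw))
      ; dominated     = λ vw → sits-dominated (sits-adj vw (r-sits vw) (r-sits (symm G vw))) (r-sits vw)
      }
      where
      c : Fin 5 → Fin n
      c = lookup cycle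

      -- The condition under which `v` can replace `c i` on the cycle.
      SitsAt : Fin n → Fin 5 → Set
      SitsAt v i = v ~ c (next i) × v ~ c (prev i)

      edge⁻ : ∀ i → c (prev i) ~ c i
      edge⁻ i = subst (λ j → c (prev i) ~ c j) (next-prev i) (edge (prev i))

      -- v misses i + 1 and i + 4, so the edge (i + 2, i + 3) must be seen.
      sees⇒sits : ∀ {v} i → v ~ c i → ∃[ j ] SitsAt v j
      sees⇒sits {v} i vi =
        [ [ (λ v₂ → next i , v₂ , subst (λ j → v ~ c j) (sym (next-prev i)) vi)
          , (λ v₃ → prev i , subst (λ j → v ~ c j) (sym (next-prev i)) vi
                  , subst (λ j → v ~ c (next (next j))) (sym (next-prev (next i))) v₃)
          ]′
        , [ (λ i₂ → contradiction (edge (next i)) (no-triangle (edge i) i₂))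
          , (λ i₃ → contradiction (edge (next (next (next i)))) (no-triangle i₃ (symm G (edge⁻ i))))
          ]′
        ]′ (2K₂-free-touch 2K₂-free vi (edge (next (next i))))

      -- If `v` sees no cycle vertex, the cycle vertices seen by `w` cover all edges of the cycle.
      -- They are independent, as there is no triangle, and an odd cycle has no independent vertex
      -- cover: `skip` leads from `i` to i + 2 and i + 4, and the last is adjacent to `i`.
      sees-some : ∀ {v w} → v ~ w → ∃[ i ] v ~ c i
      sees-some {v} {w} vw = decidable-stable (any? λ i → adj? G v (c i)) λ none →
        let w-sees : ∀ i → w ~ c i ⊎ w ~ c (next i)
            w-sees i = [ [ (λ e → contradiction (_ , e) none) , (λ e → contradiction (_ , e) none) ]′
                       , (λ e → e) ]′ (2K₂-free-touch 2K₂-free vw (edge i))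
            skip : ∀ i → w ~ c i → w ~ c (next (next i))
            skip i wi = [ (λ w₁ → contradiction (edge i) (no-triangle wi w₁)) , (λ e → e) ]′
                          (w-sees (next i))
            w-misses : ∀ i → ¬ w ~ c i
            w-misses i wi = no-triangle (skip _ (skip i wi)) wi (edge⁻ i)
        in [ w-misses 0F , w-misses 1F ]′ (w-sees 0F)

      sits? : ∀ v i → Dec (SitsAt v i)
      sits? v i = adj? G v (c (next i)) ×-dec adj? G v (c (prev i))

      r : Fin n → Fin 5
      r v with any? (sits? v)
      ... | yes (i , _) = i
      -- Only isolated vertices receive this default.
      ... | no  _       = 0F

      r-sits : ∀ {v w} → v ~ w → SitsAt v (r v)
      r-sits {v} vw with any? (sits? v)
      ... | yes (_ , sits) = sits
      ... | no  ¬sits      = contradiction (uncurry sees⇒sits (sees-some vw)) ¬sits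

      no-chord : ∀ i → ¬ c i ~ c (next (next i))
      no-chord i chord = no-triangle (edge i) chord (edge (next i))

      no-chord⁻ : ∀ i → ¬ c i ~ c (next (next (next i)))
      no-chord⁻ i chord = no-triangle chord (symm G (edge⁻ i)) (edge (next (next (next i))))

      sits-unique : ∀ i {j} → SitsAt (c i) j → j ≡ i
      sits-unique i {j} (e⁺ , e⁻) with position i j
      ... | same   = refl
      ... | ahead₁ = contradiction (subst (λ m → c i ~ c m) (next-prev i) e⁻) (irrefl G)
      ... | ahead₂ = contradiction e⁺ (no-chord⁻ i)
      ... | back₁  = contradiction e⁺ (irrefl G)
      ... | back₂  = contradiction e⁻ (no-chord _)

      -- If `i` and `j` are equal or two apart, then `v` and `w` see a common cycle vertex and form
      -- a triangle with it.
      sits-adj : ∀ {v w i j} → v ~ w → SitsAt v i → SitsAt w j → Adj C₅ i j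
      sits-adj {v} {w} {i} {j} vw (v⁺ , v⁻) (w⁺ , w⁻) with position i j
      ... | same   = contradiction w⁺ (no-triangle vw v⁺)
      ... | ahead₁ = inj₁ refl
      ... | ahead₂ =
        contradiction (subst (λ m → w ~ c m) (next-prev (next i)) w⁻) (no-triangle vw v⁺)
      ... | back₁  = inj₂ refl
      ... | back₂  =
        contradiction w⁺ (no-triangle vw (subst (λ m → v ~ c m) (next-prev (next j)) v⁻))

      sits-dominated : ∀ {v i j} → Adj C₅ i j → SitsAt v i → v ~ c j
      sits-dominated (inj₁ refl) (v⁺ , _) = v⁺
      sits-dominated {v} {j = j} (inj₂ refl) (_ , v⁻) = subst (λ m → v ~ c m) (next-prev j) v⁻

    -- Graphs with neither a triangle nor a 5-cycle: degrees and a maximal edge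

    closed-5-walk : ∀ {a b c d e} → a ~ b → b ~ c → c ~ d → d ~ e → e ~ a → Pentagon G
    closed-5-walk {a} {b} {c} {d} {e} ab bc cd de ea =
      a ∷ b ∷ c ∷ d ∷ e ∷ [] , λ { 0F → ab ; 1F → bc ; 2F → cd ; 3F → de ; 4F → ea }

    neighborhood : Fin n → Subset n
    neighborhood a = tabulate λ v → does (adj? G a v)

    ∈-neighborhood : ∀ {a v} → a ~ v → v ∈ neighborhood a
    ∈-neighborhood {a} {v} av =
      lookup⇒[]= v _ (trans (lookup∘tabulate _ v) (dec-true (adj? G a v) av))

    neighborhood-∈ : ∀ {a v} → v ∈ neighborhood a → a ~ v
    neighborhood-∈ {a} {v} v∈ with adj? G a v | trans (sym (lookup∘tabulate _ v)) ([]=⇒lookup v∈)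
    ... | yes av | _  = av
    ... | no  _  | ()

    degree : Fin n → ℕ
    degree a = ∣ neighborhood a ∣

    degree-< : ∀ {a b v} → (∀ w → a ~ w → b ~ w) → b ~ v → ¬ a ~ v → degree a < degree b
    degree-< a⊆b bv ¬av = p⊂q⇒∣p∣<∣q∣
      ( (λ w∈ → ∈-neighborhood (a⊆b _ (neighborhood-∈ w∈)))
      , _ , ∈-neighborhood bv , ¬av ∘ neighborhood-∈)

    module _ (pentagon-free : ¬ Pentagon G) where

      -- Otherwise the neighborhood of v would properly contain that of b.
      opposite : ∀ {a b v w} → a ~ b → (∀ t → a ~ t → degree t ≤ degree b) → v ~ a → v ~ w → w ~ b
      opposite {a} {b} {v} {w} ab b-max va vw = decidable-stable (adj? G w b) λ ¬wb →
        let b⊆v : ∀ y → b ~ y → v ~ y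
            b⊆v y by =
              [ [ (λ bv → contradiction bv (no-triangle ab (symm G va)))
                , (λ bw → contradiction (symm G bw) ¬wb)
                ]′
              , [ symm G
                , (λ yw → contradiction
                  (closed-5-walk (symm G va) vw (symm G yw) (symm G by) (symm G ab))
                  pentagon-free)
                ]′
              ]′ (2K₂-free-touch 2K₂-free by vw)
        in contradiction (b-max v (symm G va)) (<⇒≱ (degree-< b⊆v vw (¬wb ∘ symm G)))

      -- By `opposite` every edge joins a neighbor of `a` to a neighbor of `b`, so the neighbors of
      -- `a` fold onto `b` and all other vertices onto `a`.
      maximal-edge-core : ∀ {a b} → a ~ b →
        (∀ t → a ~ t → degree t ≤ degree b) → (∀ t → b ~ t → degree t ≤ degree a) → Core G
      maximal-edge-core {a} {b} ab b-max a-max = complete-core {k = 2} record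
        { embed         = embed
        ; retract       = r
        ; retract-embed = λ { 0F → r-out (irrefl G) ; 1F → r-in (symm G ab) }
        ; embed-adj     = λ
          { {0F} {0F} i≢i → contradiction refl i≢i
          ; {0F} {1F} _   → ab
          ; {1F} {0F} _   → symm G ab
          ; {1F} {1F} i≢i → contradiction refl i≢i
          }
        ; retract-adj   = λ vw → [ crosses , (λ ends → crosses (swap ends) ∘ sym) ]′ (ends vw)
        ; dominated     = λ {v} vw →
          [ (λ (va , wb) → subst (λ i → v ~ embed i) (sym (r-out (b-side wb))) va)
          , (λ (vb , wa) → subst (λ i → v ~ embed i) (sym (r-in wa)) vb)
          ]′ (ends vw)
        }
        where
        embed : Fin 2 → Fin n
        embed 0F = a
        embed 1F = b

        r : Fin n → Fin 2
        r v with adj? G v a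
        ... | yes _ = 1F
        ... | no  _ = 0F

        r-in : ∀ {v} → v ~ a → r v ≡ 1F
        r-in {v} va with adj? G v a
        ... | yes _  = refl
        ... | no ¬va = contradiction va ¬va

        r-out : ∀ {v} → ¬ v ~ a → r v ≡ 0F
        r-out {v} ¬va with adj? G v a
        ... | yes va = contradiction va ¬va
        ... | no  _  = refl

        b-side : ∀ {w} → w ~ b → ¬ w ~ a
        b-side wb wa = no-triangle wa wb ab

        crosses : ∀ {v w} → v ~ a × w ~ b → r v ≢ r w
        crosses (va , wb) eq with trans (sym (r-in va)) (trans eq (r-out (b-side wb)))
        ... | ()

        ends : ∀ {v w} → v ~ w → (v ~ a × w ~ b) ⊎ (v ~ b × w ~ a)
        ends vw =
          [ [ (λ va → inj₁ (va , opposite ab b-max va vw))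
            , (λ vb → inj₂ (vb , opposite (symm G ab) a-max vb vw))
            ]′
          , [ (λ wa → inj₂ (opposite ab b-max wa (symm G vw) , wa))
            , (λ wb → inj₁ (opposite (symm G ab) a-max wb (symm G vw) , wb))
            ]′
          ]′ (2K₂-free-touch 2K₂-free vw ab)

      -- An edge of maximal degree sum suffices: comparing it with an edge that shares one end and
      -- cancelling that end's degree shows that the other end is maximal.
      edge-core : ∃[ (a , b) ] a ~ b → Core G
      edge-core edge =
        let (a , b) , ab , maximal = greatest (search-× any? any?) (λ (a , b) → adj? G a b)
              (λ (a , b) → degree a + degree b) edge (n + n)
              (λ (a , b) _ → +-mono-≤ (∣p∣≤n (neighborhood a)) (∣p∣≤n (neighborhood b)))
        in maximal-edge-core ab
             (λ t at → +-cancelˡ-≤ (degree a) (degree t) (degree b) (maximal (a , t) at))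
             (λ t bt → +-cancelʳ-≤ (degree b) (degree t) (degree a) (maximal (t , b) (symm G bt)))

  -- Existence of a core and the diameter bound

  core : 2K₂ -Free G → paw -Free G → Core G
  core 2K₂-free paw-free with triangle?
  ... | yes abc = triangle-core 2K₂-free paw-free abc
  ... | no ¬triangle with pentagon?
  ...   | yes cycle = pentagon-core 2K₂-free ¬triangle cycle
  ...   | no ¬pentagon with search-× any? any? (λ (a , b) → adj? G a b)
  ...     | yes edge = edge-core 2K₂-free ¬triangle ¬pentagon edge
  ...     | no ¬edge = edgeless-core G λ u v e → ¬edge ((u , v) , e)

-- Supplies the vertex of `R ℓ G` from which `diameter` starts.
widen : ∀ {n χ ℓ} {G : Graph (Fin n)} → χ ≤ ℓ → Coloring G χ → Coloring G ℓ
widen χ≤ℓ α = proj₁ $ fromFunction (λ v → inject≤ (color α v) χ≤ℓ) λ u v e →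
  proper α u v e ∘ inject≤-injective χ≤ℓ χ≤ℓ _ _

corollary4 : (n : ℕ) (G : Graph (Fin n)) → 2K₂ -Free G → paw -Free G →
    Recolorable G ×
    (∀ χ → IsChromaticNumber G χ → ∀ ℓ → ℓ ≥ χ + 1 →
    ∃[ D ] IsDiameter (R ℓ G) D × D ≤ 2 * n ^ 2)
corollary4 n G 2K₂-free paw-free =
    (λ χ (γ , _) ℓ ℓ≥ u v → let m , _ , walk = close γ ℓ≥ u v in m , walk)
  , (λ χ (γ , _) ℓ ℓ≥ → diameter search-Coloring _≟ᶜ_
      (widen (≤-trans (m≤m+n χ 1) ℓ≥) γ) (2 * n ^ 2) (close γ ℓ≥))
  where
  open Core (core G 2K₂-free paw-free)

  -- The given coloring of `G` restricts to the core, where having fewer than `ℓ` colors makes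
  -- `dodgeable` applicable.
  close : ∀ {χ ℓ} → Coloring G χ → ℓ ≥ χ + 1 → ∀ u v → Joined (R ℓ G) u v (2 * n ^ 2)
  close {χ} γ ℓ≥ = joined (dodgeable (restrict γ) (≤-trans (≤-reflexive (+-comm 1 χ)) ℓ≥))
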